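{- Let $F$ be either the graph $2P_3$ or the claw $K_{1,3}$. Then no minimally nonperfectly divisible $F$-free graph contains a clique cutset.
   Context: Graphs are finite and simple. $2P_3$ is the disjoint union of two paths on $3$ vertices; the claw is $K_{1,3}$. $G$ is $F$-free if no induced subgraph of $G$ is isomorphic to $F$. A clique cutset of a connected graph $G$ is a clique $X$ such that $G-X$ is disconnected. A perfect division of $G$ is a partition $(A,B)$ of $V(G)$ such that $G[A]$ is perfect and $\omega(G[B])<\omega(G)$. $G$ is perfectly divisible if every nonempty induced subgraph has a perfect division; $G$ is minimally nonperfectly divisible if $G$ is not perfectly divisible but every proper induced subgraph is. -}

module Defs where

open import Data.Nat using (ℕ; _<_; _≤_)
open import Data.Bool using (Bool; true; false)
open import Data.Fin using (Fin; zero; suc)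
open import Data.Fin.Subset using (∁; Subset; _∈_; _∉_; _⊆_; _⊂_; ⊤; ∣_∣; Nonempty)
open import Data.Product using (Σ; ∃; _×_; _,_)
open import Data.Empty using (⊥)
open import Data.Sum using (_⊎_)
open import Data.Bool using (_∨_)
open import Data.Bool.Properties using (∨-comm)
open import Data.Fin using (toℕ)
open import Relation.Binary.PropositionalEquality using (refl)
open import Function.Definitions using (Injective)
open import Relation.Nullary using (¬_)
open import Relation.Binary.PropositionalEquality using (_≡_; _≢_)

record Graph (n : ℕ) : Set where
  field
    adj    : Fin n → Fin n → Bool
    sym    : ∀ u v → adj u v ≡ adj v u
    irrefl : ∀ v → adj v v ≡ false
open Graph public

Edge : ∀ {n} → Graph n → Fin n → Fin n → Set
Edge G u v = adj G u v ≡ true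

-- Induced subgraphs of G are represented by vertex subsets S (G[S]).

InducedCopy : ∀ {m n} → Graph m → Graph n → Set
InducedCopy {m} {n} F G =
  Σ (Fin m → Fin n) λ f → Injective _≡_ _≡_ f × (∀ i j → adj F i j ≡ adj G (f i) (f j))

Free : ∀ {m n} → Graph m → Graph n → Set
Free F G = ¬ InducedCopy F G

IsClique : ∀ {n} → Graph n → Subset n → Set
IsClique G K = ∀ {u v} → u ∈ K → v ∈ K → u ≢ v → Edge G u v

IsCliqueNumber : ∀ {n} → Graph n → Subset n → ℕ → Set
IsCliqueNumber G S k =
  (Σ (Subset _) λ K → K ⊆ S × IsClique G K × ∣ K ∣ ≡ k)
  × (∀ K → K ⊆ S → IsClique G K → ∣ K ∣ ≤ k)

Colourable : ∀ {n} → Graph n → Subset n → ℕ → Set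
Colourable G S k =
  Σ (∀ v → v ∈ S → Fin k) λ c →
    ∀ {u v} (hu : u ∈ S) (hv : v ∈ S) → Edge G u v → c u hu ≢ c v hv

-- G[S] is perfect: every induced subgraph H has χ(H) = ω(H)
-- (χ(H) ≥ ω(H) always holds, so this is: H is ω(H)-colourable).
Perfect : ∀ {n} → Graph n → Subset n → Set
Perfect G S = ∀ T → T ⊆ S → ∀ k → IsCliqueNumber G T k → Colourable G T k

CliqueNumberLess : ∀ {n} → Graph n → Subset n → Subset n → Set
CliqueNumberLess G B S =
  Σ ℕ λ k → Σ ℕ λ l → IsCliqueNumber G B k × IsCliqueNumber G S l × k < l

PerfectDivision : ∀ {n} → Graph n → Subset n → Subset n → Subset n → Set
PerfectDivision G S A B =
  (∀ {v} → v ∈ S → (v ∈ A × v ∉ B) ⊎ (v ∉ A × v ∈ B))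
  × A ⊆ S × B ⊆ S
  × Perfect G A
  × CliqueNumberLess G B S

PerfectlyDivisible : ∀ {n} → Graph n → Subset n → Set
PerfectlyDivisible G S =
  ∀ T → T ⊆ S → Nonempty T → Σ (Subset _) λ A → Σ (Subset _) λ B → PerfectDivision G T A B

MinimallyNonPerfectlyDivisible : ∀ {n} → Graph n → Set
MinimallyNonPerfectlyDivisible G =
  ¬ PerfectlyDivisible G ⊤ × (∀ T → T ⊂ ⊤ → PerfectlyDivisible G T)

data Reach {n} (G : Graph n) (S : Subset n) : Fin n → Fin n → Set where
  here : ∀ {v} → v ∈ S → Reach G S v v
  step : ∀ {u w v} → u ∈ S → Edge G u w → Reach G S w v → Reach G S u v

Connected : ∀ {n} → Graph n → Subset n → Set
Connected G S = Nonempty S × (∀ {u v} → u ∈ S → v ∈ S → Reach G S u v)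

Disconnected : ∀ {n} → Graph n → Subset n → Set
Disconnected G S = ∃ λ u → ∃ λ v → u ∈ S × v ∈ S × ¬ Reach G S u v

IsCliqueCutset : ∀ {n} → Graph n → Subset n → Set
IsCliqueCutset G X = IsClique G X × Disconnected G (∁ X)

HasCliqueCutset : ∀ {n} → Graph n → Set
HasCliqueCutset G = Connected G ⊤ × ∃ λ X → IsCliqueCutset G X

2P3e : ℕ → ℕ → Bool
2P3e 0 1 = true
2P3e 1 2 = true
2P3e 3 4 = true
2P3e 4 5 = true
2P3e _ _ = false

claw-e : ℕ → ℕ → Bool
claw-e 0 1 = true
claw-e 0 2 = true
claw-e 0 3 = true
claw-e _ _ = false

2P3 : Graph 6
2P3 = record
  { adj = λ i j → 2P3e (toℕ i) (toℕ j) ∨ 2P3e (toℕ j) (toℕ i)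
  ; sym = λ i j → ∨-comm (2P3e (toℕ i) (toℕ j)) (2P3e (toℕ j) (toℕ i))
  ; irrefl = irr }
  where
    irr : ∀ v → 2P3e (toℕ v) (toℕ v) ∨ 2P3e (toℕ v) (toℕ v) ≡ false
    irr zero = refl
    irr (suc zero) = refl
    irr (suc (suc zero)) = refl
    irr (suc (suc (suc zero))) = refl
    irr (suc (suc (suc (suc zero)))) = refl
    irr (suc (suc (suc (suc (suc zero))))) = refl

claw : Graph 4
claw = record
  { adj = λ i j → claw-e (toℕ i) (toℕ j) ∨ claw-e (toℕ j) (toℕ i)
  ; sym = λ i j → ∨-comm (claw-e (toℕ i) (toℕ j)) (claw-e (toℕ j) (toℕ i))
  ; irrefl = irr }
  where
    irr : ∀ v → claw-e (toℕ v) (toℕ v) ∨ claw-e (toℕ v) (toℕ v) ≡ false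
    irr zero = refl
    irr (suc zero) = refl
    irr (suc (suc zero)) = refl
    irr (suc (suc (suc zero))) = refl

{-# OPTIONS --safe #-}
-- A vertex set A is a perfect part of a perfect division iff G[A] is perfect and every clique
-- that misses A is smaller than some other clique. Let L and R be the two sides of a clique
-- cutset X. Proper induced subgraphs have such perfect parts, perfect graphs can be glued along
-- a clique, and by König's theorem (proved here by uncrossing maximum cliques) a union of two
-- cliques is perfect. So if L is a clique, a perfect part of R ∪ X extends by L to one of G.
--
-- If G is 2P₃-free, one side is P₃-free, and one of its components, a clique, can serve
-- as L.
--
-- If G is claw-free, take R maximal subject to X = N(R) \ R being a clique. Every x ∈ X then has
-- cliques N_L(x) and N_R(x) as neighbourhoods in the two sides, and N_L(x) ⊆ N_L(y) or
-- N_R(x) ⊆ N_R(y) for x , y ∈ X. Maximality forces all N_R(x) to coincide. Then a perfect part of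
-- L ∪ X, enlarged by one vertex of X if it misses X, and a perfect part of R unite to a perfect
-- part of G.
module Submission where

open import Defs
import Data.Bool.Properties as Bool
import Data.Nat.Properties as ℕ
open import Data.Bool using (true; false)
open import Data.Empty using (⊥-elim) renaming (⊥ to False)
open import Data.Fin using (Fin; zero; suc; toℕ; fromℕ<; _≟_)
open import Data.Fin.Properties
  using (any?; all?; sequence; toℕ<n; toℕ-injective; fromℕ<-injective)
open import Data.Fin.Subset
  using (Subset; _∈_; _∉_; _⊆_; ∣_∣; _∩_; _∪_; ∁; ⁅_⁆; ⊤; ⊥; Nonempty)
open import Data.Fin.Subset.Properties
open import Data.Nat using (ℕ; zero; suc; _+_; _≤_; _<_; z≤n; s≤s; _<?_)
open import Data.Nat.Induction using (<-wellFounded)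
open import Data.Product using (Σ; ∃; _×_; _,_; proj₁; proj₂)
open import Data.Sum using (_⊎_; inj₁; inj₂; [_,_]′; swap)
open import Data.Vec using ([]; _∷_; lookup; tabulate)
open import Data.Vec.Properties using (lookup∘tabulate; lookup⇒[]=; []=⇒lookup)
open import Effect.Monad using (RawMonad)
open import Function using (_∘_; id)
open import Induction.WellFounded using (Acc; acc)
open import Relation.Binary.Definitions using (tri<; tri≈; tri>)
open import Relation.Binary.PropositionalEquality
  using (_≡_; _≢_; refl; trans; cong; subst; ≢-sym) renaming (sym to ≡-sym)
open import Relation.Nullary using (¬_; Dec; yes; no; does; contradiction)
open import Relation.Nullary.Decidable
  using (map′; dec-true; _×-dec_; _⊎-dec_; _→-dec_; ¬?; ¬¬-excluded-middle; decidable-stable)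
open import Relation.Nullary.Negation using (¬¬-Monad)
open import Relation.Unary using (Decidable)

-- Subsets given by decidable predicates.

select : ∀ {n} {P : Fin n → Set} → Decidable P → Subset n
select P? = tabulate (does ∘ P?)

module _ {n} {P : Fin n → Set} (P? : Decidable P) where

  ∈-select⁺ : ∀ {v} → P v → v ∈ select P?
  ∈-select⁺ {v} p =
    lookup⇒[]= v _ (trans (lookup∘tabulate (does ∘ P?) v) (dec-true (P? v) p))

  ∈-select⁻ : ∀ {v} → v ∈ select P? → P v
  ∈-select⁻ {v} v∈ =
    witness (P? v) (trans (≡-sym (lookup∘tabulate (does ∘ P?) v)) ([]=⇒lookup v∈))
    where
    witness : ∀ {A : Set} (a? : Dec A) → does a? ≡ true → A
    witness (yes a) _ = a

full-or-missing : ∀ {n} (T : Subset n) → (∀ v → v ∈ T) ⊎ ∃ λ v → v ∉ T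
full-or-missing T with any? (λ v → ¬? (v ∈? T))
... | yes (v , v∉T) = inj₂ (v , v∉T)
... | no ∄v = inj₁ λ v → case v (v ∈? T)
  where
  case : ∀ v → Dec (v ∈ T) → v ∈ T
  case v (yes v∈T) = v∈T
  case v (no v∉T)  = contradiction (v , v∉T) ∄v

-- Uncrossing two sets along a third.

uncross : ∀ {n} → Subset n → Subset n → Subset n → Subset n
uncross P K L = (P ∩ (K ∩ L)) ∪ (∁ P ∩ (K ∪ L))

-- Modularity, point by point: at each point one of the two sets follows the intersection of `K` and
-- `L` and the other follows their union.
∣uncross∣ : ∀ {n} (P K L : Subset n) →
            ∣ uncross P K L ∣ + ∣ uncross (∁ P) K L ∣ ≡ ∣ K ∣ + ∣ L ∣
∣uncross∣ [] [] [] = refl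
∣uncross∣ (true ∷ P) (true ∷ K) (true ∷ L) =
  cong suc (trans (ℕ.+-suc _ _) (trans (cong suc (∣uncross∣ P K L)) (≡-sym (ℕ.+-suc _ _))))
∣uncross∣ (true ∷ P) (true ∷ K) (false ∷ L) =
  trans (ℕ.+-suc _ _) (cong suc (∣uncross∣ P K L))
∣uncross∣ (true ∷ P) (false ∷ K) (true ∷ L) =
  trans (ℕ.+-suc _ _) (trans (cong suc (∣uncross∣ P K L)) (≡-sym (ℕ.+-suc _ _)))
∣uncross∣ (true ∷ P) (false ∷ K) (false ∷ L) = ∣uncross∣ P K L
∣uncross∣ (false ∷ P) (true ∷ K) (true ∷ L) =
  cong suc (trans (ℕ.+-suc _ _) (trans (cong suc (∣uncross∣ P K L)) (≡-sym (ℕ.+-suc _ _))))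
∣uncross∣ (false ∷ P) (true ∷ K) (false ∷ L) = cong suc (∣uncross∣ P K L)
∣uncross∣ (false ∷ P) (false ∷ K) (true ∷ L) =
  trans (cong suc (∣uncross∣ P K L)) (≡-sym (ℕ.+-suc _ _))
∣uncross∣ (false ∷ P) (false ∷ K) (false ∷ L) = ∣uncross∣ P K L

∈-uncross⁻ : ∀ {n} (P K L : Subset n) {v} → v ∈ uncross P K L →
             (v ∈ P × v ∈ K × v ∈ L) ⊎ (v ∉ P × (v ∈ K ⊎ v ∈ L))
∈-uncross⁻ P K L v∈ with x∈p∪q⁻ _ _ v∈
... | inj₁ h = let v∈P , v∈KL = x∈p∩q⁻ P _ h in inj₁ (v∈P , x∈p∩q⁻ K L v∈KL)
... | inj₂ h = let v∉P , v∈KL = x∈p∩q⁻ (∁ P) _ h in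
               inj₂ (x∈∁p⇒x∉p v∉P , x∈p∪q⁻ K L v∈KL)

-- Cliques, colourings and perfection.

module Colouring {n} (G : Graph n) where

  Clique : Subset n → Set
  Clique = IsClique G

  edge? : ∀ u v → Dec (Edge G u v)
  edge? u v = adj G u v Bool.≟ true

  edge-sym : ∀ {u v} → Edge G u v → Edge G v u
  edge-sym {u} {v} e = trans (sym G v u) e

  edge-irrefl : ∀ {u v} → Edge G u v → u ≢ v
  edge-irrefl {u} e refl with () ← trans (≡-sym e) (irrefl G u)

  clique? : Decidable Clique
  clique? K = map′ (λ f u∈K v∈K → f _ _ u∈K v∈K) (λ f u v → f)
    (all? λ u → all? λ v →
      (u ∈? K) →-dec ((v ∈? K) →-dec (¬? (u ≟ v) →-dec edge? u v)))

  clique-⁅⁆ : ∀ v → Clique ⁅ v ⁆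
  clique-⁅⁆ v a∈ b∈ a≢b =
    contradiction (trans (x∈⁅y⁆⇒x≡y v a∈) (≡-sym (x∈⁅y⁆⇒x≡y v b∈))) a≢b

  clique-insert : ∀ {K v} → Clique K → (∀ {u} → u ∈ K → Edge G u v) → Clique (K ∪ ⁅ v ⁆)
  clique-insert {K} {v} cl e a∈ b∈ a≢b with x∈p∪q⁻ K _ a∈ | x∈p∪q⁻ K _ b∈
  ... | inj₁ a∈K | inj₁ b∈K = cl a∈K b∈K a≢b
  ... | inj₁ a∈K | inj₂ b≡v rewrite x∈⁅y⁆⇒x≡y v b≡v = e a∈K
  ... | inj₂ a≡v | inj₁ b∈K rewrite x∈⁅y⁆⇒x≡y v a≡v = edge-sym (e b∈K)
  ... | inj₂ a≡v | inj₂ b≡v = clique-⁅⁆ v a≡v b≡v a≢b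

  ∣insert∣ : ∀ {K : Subset n} {v} → v ∉ K → ∣ K ∣ < ∣ K ∪ ⁅ v ⁆ ∣
  ∣insert∣ {K} {v} v∉K =
    p⊂q⇒∣p∣<∣q∣ (p⊆p∪q _ , v , q⊆p∪q K _ (x∈⁅x⁆ v) , v∉K)

  Bounded : Subset n → ℕ → Set
  Bounded T k = ∀ K → K ⊆ T → Clique K → ∣ K ∣ ≤ k

  bounded-or-clique : ∀ T k →
    Bounded T k ⊎ ∃ λ K → K ⊆ T × Clique K × k < ∣ K ∣
  bounded-or-clique T k
    with anySubset? (λ K → (K ⊆? T) ×-dec (clique? K ×-dec (k <? ∣ K ∣)))
  ... | yes K = inj₂ K
  ... | no ∄K = inj₁ λ K K⊆T cl → ℕ.≮⇒≥ λ k<K → ∄K (K , K⊆T , cl , k<K)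

  cliqueNumber : ∀ T → ∃ λ k → IsCliqueNumber G T k
  cliqueNumber T = search n λ K _ _ → ∣p∣≤n K
    where
    search : ∀ k → Bounded T k → ∃ λ l → IsCliqueNumber G T l
    search zero b = 0 , (⊥ , ⊥⊆ , (λ u∈ → contradiction u∈ ∉⊥) , ∣⊥∣≡0 n) , b
    search (suc k) b with bounded-or-clique T k
    ... | inj₁ b′ = search k b′
    ... | inj₂ (K , K⊆T , cl , k<K) = suc k , (K , K⊆T , cl , ℕ.≤-antisym (b K K⊆T cl) k<K) , b

  -- The value of the colour function outside T is irrelevant.
  Col : Subset n → ℕ → Set
  Col T k = Σ (Fin n → ℕ) λ c →
    (∀ {v} → v ∈ T → c v < k) × (∀ {u v} → u ∈ T → v ∈ T → Edge G u v → c u ≢ c v)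

  col-≤ : ∀ {T k l} → k ≤ l → Col T k → Col T l
  col-≤ k≤l (c , c< , proper) = c , (λ v∈ → ℕ.<-≤-trans (c< v∈) k≤l) , proper

  col-empty : ∀ {T k} → (∀ {v} → v ∉ T) → Col T k
  col-empty ∄v = (λ _ → 0) , (λ v∈ → contradiction v∈ ∄v) , (λ v∈ → contradiction v∈ ∄v)

  col-addClass : ∀ {S T k} → Col S k →
    (∀ {u v} → u ∈ T → u ∉ S → v ∈ T → v ∉ S → ¬ Edge G u v) → Col T (suc k)
  col-addClass {S} {T} {k} (c , c< , proper) stable =
    (λ v → colour v (v ∈? S)) , (λ {v} _ → colour< v (v ∈? S)) ,
    λ {u} {v} u∈ v∈ e → colour≢ u v u∈ v∈ e (u ∈? S) (v ∈? S)
    where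
    colour : ∀ v → Dec (v ∈ S) → ℕ
    colour v (yes _) = c v
    colour v (no _)  = k
    colour< : ∀ v v∈? → colour v v∈? < suc k
    colour< v (yes v∈) = ℕ.m<n⇒m<1+n (c< v∈)
    colour< v (no _)   = ℕ.n<1+n k
    colour≢ : ∀ u v → u ∈ T → v ∈ T → Edge G u v → ∀ u∈? v∈? → colour u u∈? ≢ colour v v∈?
    colour≢ u v _  _  e (yes u∈) (yes v∈) = proper u∈ v∈ e
    colour≢ u v _  _  e (yes u∈) (no _)   = ℕ.<⇒≢ (c< u∈)
    colour≢ u v _  _  e (no _)   (yes v∈) = ≢-sym (ℕ.<⇒≢ (c< v∈))
    colour≢ u v u∈ v∈ e (no u∉)  (no v∉)  = contradiction e (stable u∈ u∉ v∈ v∉)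

  -- Colour `i` is free on `S`, so the top colour `k` is renamed to `i`. For `i` equal to `k` the
  -- colouring stays as it is.
  col-dropClass : ∀ {S T k i} → S ⊆ T → ((c , _) : Col T (suc k)) → i < suc k →
    (∀ {v} → v ∈ S → c v ≢ i) → Col S k
  col-dropClass {S} {T} {k} {i} S⊆T (c , c< , proper) i<1+k c≢i =
    (λ v → recolour (c v) (c v ℕ.≟ k)) ,
    (λ {v} v∈ → recolour< _ (c v ℕ.≟ k) (c< (S⊆T v∈)) (c≢i v∈)) ,
    λ {u} {v} u∈ v∈ e → recolour≢ _ _ (c u ℕ.≟ k) (c v ℕ.≟ k)
                          (c≢i u∈) (c≢i v∈) (proper (S⊆T u∈) (S⊆T v∈) e)
    where
    recolour : ∀ a → Dec (a ≡ k) → ℕ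
    recolour a (yes _) = i
    recolour a (no _)  = a
    recolour< : ∀ a a≟k → a < suc k → a ≢ i → recolour a a≟k < k
    recolour< a (yes a≡k) _ a≢i = ℕ.≤∧≢⇒< (ℕ.≤-pred i<1+k) λ i≡k → a≢i (trans a≡k (≡-sym i≡k))
    recolour< a (no a≢k) a<1+k _ = ℕ.≤∧≢⇒< (ℕ.≤-pred a<1+k) a≢k
    recolour≢ : ∀ a b a≟k b≟k → a ≢ i → b ≢ i → a ≢ b → recolour a a≟k ≢ recolour b b≟k
    recolour≢ a b (yes p) (yes q) _ _ a≢b = contradiction (trans p (≡-sym q)) a≢b
    recolour≢ a b (yes _) (no _) _ b≢i _ = ≢-sym b≢i
    recolour≢ a b (no _) (yes _) a≢i _ _ = a≢i
    recolour≢ a b (no _) (no _) _ _ a≢b = a≢b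

  Perf : Subset n → Set
  Perf A = ∀ T → T ⊆ A → ∀ k → Bounded T k → Col T k

  perf⇒perfect : ∀ {A} → Perf A → Perfect G A
  perf⇒perfect perf T T⊆A k (_ , b) with perf T T⊆A k b
  ... | c , c< , proper = (λ v v∈ → fromℕ< (c< v∈)) ,
    λ u∈ v∈ e eq → proper u∈ v∈ e (fromℕ<-injective _ _ (c< u∈) (c< v∈) eq)

  perfect⇒perf : ∀ {A} → Perfect G A → Perf A
  perfect⇒perf {A} perf T T⊆A k b with cliqueNumber T
  ... | l , num@((K , K⊆T , cl , ∣K∣≡l) , _) = col-≤ (subst (_≤ k) ∣K∣≡l (b K K⊆T cl)) col
    where
    c = proj₁ (perf T T⊆A l num)
    colour : ∀ v → Dec (v ∈ T) → ℕ
    colour v (yes v∈) = toℕ (c v v∈)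
    colour v (no _)   = 0
    colour< : ∀ v v∈? → v ∈ T → colour v v∈? < l
    colour< v (yes v∈) _ = toℕ<n (c v v∈)
    colour< v (no v∉) v∈ = contradiction v∈ v∉
    colour≢ : ∀ u v u∈? v∈? → u ∈ T → v ∈ T → Edge G u v → colour u u∈? ≢ colour v v∈?
    colour≢ u v (yes u∈) (yes v∈) _ _ e =
      proj₂ (perf T T⊆A l num) u∈ v∈ e ∘ toℕ-injective
    colour≢ u v (no u∉) _ u∈ _ _ = contradiction u∈ u∉
    colour≢ u v _ (no v∉) _ v∈ _ = contradiction v∈ v∉
    col : Col T l
    col = (λ v → colour v (v ∈? T)) , (λ {v} v∈ → colour< v (v ∈? T) v∈) ,
          λ {u} {v} → colour≢ u v (u ∈? T) (v ∈? T)

  -- Gluing perfect graphs along a clique.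

  module Glue {P Q : Subset n} (meet : Clique (P ∩ Q))
    (apart : ∀ {u v} → u ∈ P → u ∉ Q → v ∈ Q → v ∉ P → ¬ Edge G u v) where

    -- Induction on `k` replaces permuting the colours of one side to agree with the other on the
    -- clique: a class of each side is removed, and their union becomes one colour class of `T`.
    col-glue : ∀ k T → T ⊆ P ∪ Q → Col (T ∩ P) k → Col (T ∩ Q) k → Col T k
    col-glue zero T T⊆ (_ , c< , _) (_ , d< , _) = col-empty λ v∈T →
      [ (λ v∈P → ℕ.n≮0 (c< (x∈p∩q⁺ (v∈T , v∈P)))) ,
        (λ v∈Q → ℕ.n≮0 (d< (x∈p∩q⁺ (v∈T , v∈Q)))) ]′ (x∈p∪q⁻ P Q (T⊆ v∈T))
    col-glue (suc k) T T⊆ C@(c , c< , c-proper) D@(d , d< , d-proper) =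
      match classes
      where
      -- Such a pair of classes can be removed from P and Q together, which lowers k.
      Classes : Set
      Classes = Σ ℕ λ i → Σ ℕ λ j → i < suc k × j < suc k ×
        (∀ {v} → v ∈ T → v ∈ P → v ∈ Q → (c v ≡ i → d v ≡ j) × (d v ≡ j → c v ≡ i))
      classes : Classes
      classes with any? (λ v → (v ∈? T) ×-dec ((v ∈? P) ×-dec (v ∈? Q)))
      -- If `T` misses `P ∩ Q`, any two classes match vacuously.
      ... | no ∄v = 0 , 0 , s≤s z≤n , s≤s z≤n ,
                    λ v∈T v∈P v∈Q → contradiction (_ , v∈T , v∈P , v∈Q) ∄v
      -- Since `P ∩ Q` is a clique, `v` is the only vertex of `T` in it with colour `c v` or with
      -- colour `d v`, so these two classes match.
      ... | yes (v , v∈T , v∈P , v∈Q) =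
        c v , d v , c< (x∈p∩q⁺ (v∈T , v∈P)) , d< (x∈p∩q⁺ (v∈T , v∈Q)) , agree
        where
        agree : ∀ {u} → u ∈ T → u ∈ P → u ∈ Q → (c u ≡ c v → d u ≡ d v) × (d u ≡ d v → c u ≡ c v)
        agree {u} u∈T u∈P u∈Q with u ≟ v
        ... | yes refl = (λ _ → refl) , (λ _ → refl)
        ... | no u≢v =
          (λ eq → contradiction eq (c-proper (x∈p∩q⁺ (u∈T , u∈P)) (x∈p∩q⁺ (v∈T , v∈P)) e)) ,
          (λ eq → contradiction eq (d-proper (x∈p∩q⁺ (u∈T , u∈Q)) (x∈p∩q⁺ (v∈T , v∈Q)) e))
          where e = meet (x∈p∩q⁺ (u∈P , u∈Q)) (x∈p∩q⁺ (v∈P , v∈Q)) u≢v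
      match : Classes → Col T (suc k)
      match (i , j , i< , j< , agree) = col-addClass
        (col-glue k S (T⊆ ∘ S⊆T)
          (col-dropClass (∩-mono P) C i< λ v∈ → let v∈S , v∈P = x∈p∩q⁻ S P v∈ in
             proj₁ (proj₂ (∈-select⁻ keep? v∈S)) v∈P)
          (col-dropClass (∩-mono Q) D j< λ v∈ → let v∈S , v∈Q = x∈p∩q⁻ S Q v∈ in
             proj₂ (proj₂ (∈-select⁻ keep? v∈S)) v∈Q))
        stable
        where
        Keep : Fin n → Set
        Keep v = v ∈ T × (v ∈ P → c v ≢ i) × (v ∈ Q → d v ≢ j)
        keep? : Decidable Keep
        keep? v = (v ∈? T) ×-dec
          (((v ∈? P) →-dec ¬? (c v ℕ.≟ i)) ×-dec ((v ∈? Q) →-dec ¬? (d v ℕ.≟ j)))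
        S = select keep?
        S⊆T : S ⊆ T
        S⊆T = proj₁ ∘ ∈-select⁻ keep?
        ∩-mono : ∀ R → S ∩ R ⊆ T ∩ R
        ∩-mono R v∈ = let v∈S , v∈R = x∈p∩q⁻ S R v∈ in x∈p∩q⁺ (S⊆T v∈S , v∈R)
        dropped : ∀ {v} → v ∈ T → v ∉ S → (v ∈ P × c v ≡ i) ⊎ (v ∈ Q × d v ≡ j)
        dropped {v} v∈T v∉S with (v ∈? P) ×-dec (c v ℕ.≟ i) | (v ∈? Q) ×-dec (d v ℕ.≟ j)
        ... | yes p | _     = inj₁ p
        ... | no _  | yes q = inj₂ q
        ... | no ¬p | no ¬q = contradiction
          (∈-select⁺ keep? (v∈T , (λ v∈P eq → ¬p (v∈P , eq)) , (λ v∈Q eq → ¬q (v∈Q , eq)))) v∉S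
        -- By `apart` an edge between the two classes would have an end in `P ∩ Q`. The classes
        -- agree there, so both ends would have one colour on one side.
        mixed : ∀ {u v} → u ∈ T → v ∈ T → u ∈ P → c u ≡ i → v ∈ Q → d v ≡ j → ¬ Edge G u v
        mixed {u} {v} u∈T v∈T u∈P cu v∈Q dv e with u ∈? Q | v ∈? P
        ... | yes u∈Q | _ = d-proper (x∈p∩q⁺ (u∈T , u∈Q)) (x∈p∩q⁺ (v∈T , v∈Q)) e
                              (trans (proj₁ (agree u∈T u∈P u∈Q) cu) (≡-sym dv))
        ... | no _ | yes v∈P = c-proper (x∈p∩q⁺ (u∈T , u∈P)) (x∈p∩q⁺ (v∈T , v∈P)) e
                              (trans cu (≡-sym (proj₂ (agree v∈T v∈P v∈Q) dv)))
        ... | no u∉Q | no v∉P = apart u∈P u∉Q v∈Q v∉P e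
        stable : ∀ {u v} → u ∈ T → u ∉ S → v ∈ T → v ∉ S → ¬ Edge G u v
        stable u∈T u∉S v∈T v∉S e with dropped u∈T u∉S | dropped v∈T v∉S
        ... | inj₁ (u∈P , cu) | inj₁ (v∈P , cv) =
          c-proper (x∈p∩q⁺ (u∈T , u∈P)) (x∈p∩q⁺ (v∈T , v∈P)) e (trans cu (≡-sym cv))
        ... | inj₂ (u∈Q , du) | inj₂ (v∈Q , dv) =
          d-proper (x∈p∩q⁺ (u∈T , u∈Q)) (x∈p∩q⁺ (v∈T , v∈Q)) e (trans du (≡-sym dv))
        ... | inj₁ (u∈P , cu) | inj₂ (v∈Q , dv) = mixed u∈T v∈T u∈P cu v∈Q dv e
        ... | inj₂ (u∈Q , du) | inj₁ (v∈P , cv) = mixed v∈T u∈T v∈P cv u∈Q du (edge-sym e)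

    perf-glue : Perf P → Perf Q → Perf (P ∪ Q)
    perf-glue perfP perfQ T T⊆ k b = col-glue k T T⊆
      (perfP (T ∩ P) (p∩q⊆q T P) k λ K K⊆ → b K (p∩q⊆p T P ∘ K⊆))
      (perfQ (T ∩ Q) (p∩q⊆q T Q) k λ K K⊆ → b K (p∩q⊆p T Q ∘ K⊆))

  open Glue public using (perf-glue)

  -- König's theorem: a union of two cliques is perfect.

  -- Inside `P` only common vertices of `K` and `L` survive, and these are adjacent to everything
  -- else in either clique. Only pairs outside `P` remain to be checked.
  uncross-clique : ∀ {P K L} →
                   (∀ {u v} → u ∈ K ⊎ u ∈ L → u ∉ P → v ∈ K ⊎ v ∈ L → v ∉ P →
                     u ≢ v → Edge G u v) →
                   Clique K → Clique L → Clique (uncross P K L)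
  uncross-clique {P} {K} {L} outside clK clL u∈ v∈ u≢v
    with ∈-uncross⁻ P K L u∈ | ∈-uncross⁻ P K L v∈
  ... | inj₁ (u∈P , u∈K , _) | inj₁ (v∈P , v∈K , _) = clK u∈K v∈K u≢v
  ... | inj₁ (_ , u∈K , u∈L) | inj₂ (_ , v∈KL) =
    [ (λ v∈K → clK u∈K v∈K u≢v) , (λ v∈L → clL u∈L v∈L u≢v) ]′ v∈KL
  ... | inj₂ (_ , u∈KL) | inj₁ (_ , v∈K , v∈L) =
    [ (λ u∈K → clK u∈K v∈K u≢v) , (λ u∈L → clL u∈L v∈L u≢v) ]′ u∈KL
  ... | inj₂ (u∉P , u∈KL) | inj₂ (v∉P , v∈KL) = outside u∈KL u∉P v∈KL v∉P u≢v

  -- Induction on `k`. For a fixed vertex `q`, the aim is a colour class, either `q` alone or `q`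
  -- with a non-neighbour, that meets every clique of size `k + 1` in `T`.
  col-cobipartite : ∀ k {P Q T} → Clique P → Clique Q → (∀ {v} → v ∈ T → v ∈ P ⊎ v ∈ Q) →
                    Bounded T k → Col T k
  col-cobipartite zero {T = T} clP clQ T⊆ b = col-empty λ {v} v∈T →
    ℕ.<⇒≱ (subst (0 <_) (≡-sym (∣⁅x⁆∣≡1 v)) (s≤s z≤n))
      (b ⁅ v ⁆ (λ u∈ → subst (_∈ T) (≡-sym (x∈⁅y⁆⇒x≡y v u∈)) v∈T) (clique-⁅⁆ v))
  col-cobipartite (suc k) {P} {Q} {T} clP clQ T⊆ b with nonempty? T
  ... | no T∅ = col-empty λ v∈T → T∅ (_ , v∈T)
  ... | yes (q , q∈T) =
    -- The two cliques are exchanged if necessary, so that below `q` lies in `Q`.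
    [ (λ q∈P → from clQ clP (swap ∘ T⊆) q∈P) , (λ q∈Q → from clP clQ T⊆ q∈Q) ]′ (T⊆ q∈T)
    where
    module _ {P Q : Subset n} (clP : Clique P) (clQ : Clique Q)
             (T⊆ : ∀ {v} → v ∈ T → v ∈ P ⊎ v ∈ Q) (q∈Q : q ∈ Q) where

      avoids? : ∀ p → Decidable λ v → v ∈ T × v ≢ p × v ≢ q
      avoids? p v = (v ∈? T) ×-dec (¬? (v ≟ p) ×-dec ¬? (v ≟ q))

      removePair : ∀ p → ¬ Edge G p q →
        Col T (suc k) ⊎ ∃ λ K → K ⊆ T × Clique K × k < ∣ K ∣ × p ∉ K × q ∉ K
      removePair p p≁q with bounded-or-clique (select (avoids? p)) k
      ... | inj₁ b′ = inj₁ (col-addClass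
              (col-cobipartite k clP clQ (T⊆ ∘ proj₁ ∘ ∈-select⁻ (avoids? p)) b′) stable)
        where
        pq : ∀ {v} → v ∈ T → v ∉ select (avoids? p) → v ≡ p ⊎ v ≡ q
        pq {v} v∈T v∉S with v ≟ p | v ≟ q
        ... | yes v≡p | _ = inj₁ v≡p
        ... | no _ | yes v≡q = inj₂ v≡q
        ... | no v≢p | no v≢q = contradiction (∈-select⁺ (avoids? p) (v∈T , v≢p , v≢q)) v∉S
        stable : ∀ {u v} → u ∈ T → u ∉ select (avoids? p) → v ∈ T → v ∉ select (avoids? p) →
                 ¬ Edge G u v
        stable u∈T u∉ v∈T v∉ e with pq u∈T u∉ | pq v∈T v∉
        ... | inj₁ refl | inj₁ refl = edge-irrefl e refl
        ... | inj₁ refl | inj₂ refl = p≁q e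
        ... | inj₂ refl | inj₁ refl = p≁q (edge-sym e)
        ... | inj₂ refl | inj₂ refl = edge-irrefl e refl
      ... | inj₂ (K , K⊆ , cl , k<K) =
        inj₂ (K , proj₁ ∘ ∈-select⁻ (avoids? p) ∘ K⊆ , cl , k<K ,
              (λ p∈K → proj₁ (proj₂ (∈-select⁻ (avoids? p) (K⊆ p∈K))) refl) ,
              (λ q∈K → proj₂ (proj₂ (∈-select⁻ (avoids? p) (K⊆ q∈K))) refl))

      -- If every p not adjacent to q is missed, along with q, by some clique of size k + 1, then
      -- uncrossing these cliques yields one to which q is complete: a clique of size k + 2.
      descend : ∀ K → Acc _<_ ∣ K ∩ P ∣ → K ⊆ T → Clique K → k < ∣ K ∣ → q ∉ K → Col T (suc k)
      descend K (acc rec) K⊆T clK k<K q∉K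
        with any? (λ p → (p ∈? K) ×-dec ¬? (edge? p q))
      ... | no ∄p = contradiction (ℕ.≤-<-trans k<K (∣insert∣ q∉K))
              (ℕ.≤⇒≯ (b (K ∪ ⁅ q ⁆)
                ([ K⊆T , (λ v∈ → subst (_∈ T) (≡-sym (x∈⁅y⁆⇒x≡y q v∈)) q∈T) ]′ ∘ x∈p∪q⁻ K _)
                (clique-insert clK joined)))
        where
        joined : ∀ {u} → u ∈ K → Edge G u q
        joined {u} u∈K with edge? u q
        ... | yes e = e
        ... | no u≁q = contradiction (u , u∈K , u≁q) ∄p
      ... | yes (p , p∈K , p≁q) with removePair p p≁q
      ...   | inj₁ col = col
      ...   | inj₂ (L , L⊆T , clL , k<L , p∉L , q∉L) =
        descend M (rec M∩P<) M⊆T clM k<M ([ q∉K , q∉L ]′ ∘ in-KL)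
        where
        M = uncross P K L
        N = uncross (∁ P) K L
        in-KL : ∀ {R v} → v ∈ uncross R K L → v ∈ K ⊎ v ∈ L
        in-KL {R} v∈ = [ inj₁ ∘ proj₁ ∘ proj₂ , proj₂ ]′ (∈-uncross⁻ R K L v∈)
        KL⊆T : ∀ {v} → v ∈ K ⊎ v ∈ L → v ∈ T
        KL⊆T = [ K⊆T , L⊆T ]′
        M⊆T : M ⊆ T
        M⊆T = KL⊆T ∘ in-KL
        inQ : ∀ {v} → v ∈ K ⊎ v ∈ L → v ∉ P → v ∈ Q
        inQ v∈ v∉P = [ (λ v∈P → contradiction v∈P v∉P) , id ]′ (T⊆ (KL⊆T v∈))
        clM : Clique M
        clM = uncross-clique (λ u∈ u∉P v∈ v∉P → clQ (inQ u∈ u∉P) (inQ v∈ v∉P)) clK clL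
        clN : Clique N
        clN = uncross-clique (λ _ u∉ _ v∉ → clP (x∉∁p⇒x∈p u∉) (x∉∁p⇒x∈p v∉)) clK clL
        -- `N` is also a clique in `T`, so it has at most `k + 1` vertices, whereas `M` and `N`
        -- together have as many as `K` and `L`, at least `2k + 2`.
        k<M : k < ∣ M ∣
        k<M = ℕ.≮⇒≥ λ M<1+k → ℕ.<⇒≱
          (ℕ.+-mono-<-≤ M<1+k (b N (KL⊆T ∘ in-KL) clN))
          (subst (suc k + suc k ≤_) (≡-sym (∣uncross∣ P K L)) (ℕ.+-mono-≤ k<K k<L))
        -- `Q` is a clique containing `q`, so the non-neighbour `p` lies on the other side.
        p∈P : p ∈ P
        p∈P with T⊆ (K⊆T p∈K)
        ... | inj₁ p∈P = p∈P
        ... | inj₂ p∈Q = contradiction (clQ p∈Q q∈Q λ { refl → q∉K p∈K }) p≁q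
        M∩P⊆ : ∀ {v} → v ∈ M ∩ P → v ∈ K × v ∈ L × v ∈ P
        M∩P⊆ v∈ with x∈p∩q⁻ M P v∈
        ... | v∈M , v∈P with ∈-uncross⁻ P K L v∈M
        ...   | inj₁ (_ , v∈K , v∈L) = v∈K , v∈L , v∈P
        ...   | inj₂ (v∉P , _) = contradiction v∈P v∉P
        -- Inside `P`, uncrossing keeps only common vertices of `K` and `L`; this loses `p`, which
        -- `L` misses.
        M∩P< : ∣ M ∩ P ∣ < ∣ K ∩ P ∣
        M∩P< = p⊂q⇒∣p∣<∣q∣
          ((λ v∈ → let v∈K , _ , v∈P = M∩P⊆ v∈ in x∈p∩q⁺ (v∈K , v∈P)) ,
           p , x∈p∩q⁺ (p∈K , p∈P) , λ p∈ → p∉L (proj₁ (proj₂ (M∩P⊆ p∈))))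

      from : Col T (suc k)
      -- Taking `q` as its own partner tries the class consisting of `q` alone. Failure yields the
      -- clique from which the descent starts.
      from with removePair q (λ e → edge-irrefl e refl)
      ... | inj₁ col = col
      ... | inj₂ (K , K⊆T , cl , k<K , _ , q∉K) = descend K (<-wellFounded _) K⊆T cl k<K q∉K

  perf-cobipartite : ∀ {P Q A} → Clique P → Clique Q → (∀ {v} → v ∈ A → v ∈ P ⊎ v ∈ Q) → Perf A
  perf-cobipartite clP clQ A⊆ T T⊆A k = col-cobipartite k clP clQ (A⊆ ∘ T⊆A)

-- Induced copies of the two forbidden graphs, and the sides of a clique cutset.

module Cutsets {n} (G : Graph n) where

  open Colouring G

  nonEdge : ∀ {u v} → ¬ Edge G u v → adj G u v ≡ false
  nonEdge = Bool.¬-not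

  -- Symmetry and irreflexivity of both graphs settle all pairs that are not increasing.
  embed : ∀ {m} (F : Graph m) (f : Fin m → Fin n) →
    (∀ i j → toℕ i < toℕ j → f i ≢ f j × adj F i j ≡ adj G (f i) (f j)) → InducedCopy F G
  embed F f ordered = f , injective , preserves
    where
    injective : ∀ {i j} → f i ≡ f j → i ≡ j
    injective {i} {j} eq with ℕ.<-cmp (toℕ i) (toℕ j)
    ... | tri< i<j _ _ = contradiction eq (proj₁ (ordered i j i<j))
    ... | tri≈ _ i≡j _ = toℕ-injective i≡j
    ... | tri> _ _ j<i = contradiction (≡-sym eq) (proj₁ (ordered j i j<i))
    preserves : ∀ i j → adj F i j ≡ adj G (f i) (f j)
    preserves i j with ℕ.<-cmp (toℕ i) (toℕ j)
    ... | tri< i<j _ _ = proj₂ (ordered i j i<j)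
    ... | tri≈ _ i≡j _ rewrite toℕ-injective i≡j =
      trans (irrefl F j) (≡-sym (irrefl G (f j)))
    ... | tri> _ _ j<i =
      trans (sym F i j) (trans (proj₂ (ordered j i j<i)) (sym G (f j) (f i)))

  claw-copy : ∀ {x a b c} → Edge G x a → Edge G x b → Edge G x c →
    a ≢ b → a ≢ c → b ≢ c → ¬ Edge G a b → ¬ Edge G a c → ¬ Edge G b c → InducedCopy claw G
  claw-copy {x} {a} {b} {c} xa xb xc a≢b a≢c b≢c a≁b a≁c b≁c =
    embed claw (lookup (x ∷ a ∷ b ∷ c ∷ [])) λ where
      zero (suc zero) _ → edge xa
      zero (suc (suc zero)) _ → edge xb
      zero (suc (suc (suc zero))) _ → edge xc
      (suc zero) (suc (suc zero)) _ → a≢b , ≡-sym (nonEdge a≁b)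
      (suc zero) (suc (suc (suc zero))) _ → a≢c , ≡-sym (nonEdge a≁c)
      (suc (suc zero)) (suc (suc (suc zero))) _ → b≢c , ≡-sym (nonEdge b≁c)
      zero zero ()
      (suc zero) (suc zero) (s≤s ())
      (suc (suc zero)) (suc zero) (s≤s ())
      (suc (suc zero)) (suc (suc zero)) (s≤s (s≤s ()))
      (suc (suc (suc zero))) (suc zero) (s≤s ())
      (suc (suc (suc zero))) (suc (suc zero)) (s≤s (s≤s ()))
      (suc (suc (suc zero))) (suc (suc (suc zero))) (s≤s (s≤s (s≤s ())))
    where
    edge : ∀ {u v} → Edge G u v → u ≢ v × true ≡ adj G u v
    edge e = edge-irrefl e , ≡-sym e

  InducedP3 : (a b c : Fin n) → Set
  InducedP3 a b c = Edge G a b × Edge G b c × ¬ Edge G a c × a ≢ c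

  2P3-copy : ∀ {a b c d e f} → InducedP3 a b c → InducedP3 d e f →
    (∀ {u v} → u ≡ a ⊎ u ≡ b ⊎ u ≡ c → v ≡ d ⊎ v ≡ e ⊎ v ≡ f → u ≢ v × ¬ Edge G u v) →
    InducedCopy 2P3 G
  2P3-copy {a} {b} {c} {d} {e} {f} (ab , bc , a≁c , a≢c) (de , ef , d≁f , d≢f) far =
    embed 2P3 (lookup (a ∷ b ∷ c ∷ d ∷ e ∷ f ∷ [])) λ where
      zero (suc zero) _ → edge ab
      zero (suc (suc zero)) _ → a≢c , ≡-sym (nonEdge a≁c)
      (suc zero) (suc (suc zero)) _ → edge bc
      (suc (suc (suc zero))) (suc (suc (suc (suc zero)))) _ → edge de
      (suc (suc (suc zero))) (suc (suc (suc (suc (suc zero))))) _ → d≢f , ≡-sym (nonEdge d≁f)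
      (suc (suc (suc (suc zero)))) (suc (suc (suc (suc (suc zero))))) _ → edge ef
      zero (suc (suc (suc zero))) _ → apart (inj₁ refl) (inj₁ refl)
      zero (suc (suc (suc (suc zero)))) _ → apart (inj₁ refl) (inj₂ (inj₁ refl))
      zero (suc (suc (suc (suc (suc zero))))) _ → apart (inj₁ refl) (inj₂ (inj₂ refl))
      (suc zero) (suc (suc (suc zero))) _ → apart (inj₂ (inj₁ refl)) (inj₁ refl)
      (suc zero) (suc (suc (suc (suc zero)))) _ → apart (inj₂ (inj₁ refl)) (inj₂ (inj₁ refl))
      (suc zero) (suc (suc (suc (suc (suc zero))))) _ →
        apart (inj₂ (inj₁ refl)) (inj₂ (inj₂ refl))
      (suc (suc zero)) (suc (suc (suc zero))) _ → apart (inj₂ (inj₂ refl)) (inj₁ refl)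
      (suc (suc zero)) (suc (suc (suc (suc zero)))) _ →
        apart (inj₂ (inj₂ refl)) (inj₂ (inj₁ refl))
      (suc (suc zero)) (suc (suc (suc (suc (suc zero))))) _ →
        apart (inj₂ (inj₂ refl)) (inj₂ (inj₂ refl))
      zero zero ()
      (suc zero) (suc zero) (s≤s ())
      (suc (suc _)) (suc zero) (s≤s ())
      (suc (suc zero)) (suc (suc zero)) (s≤s (s≤s ()))
      (suc (suc (suc _))) (suc (suc zero)) (s≤s (s≤s ()))
      (suc (suc (suc zero))) (suc (suc (suc zero))) (s≤s (s≤s (s≤s ())))
      (suc (suc (suc (suc _)))) (suc (suc (suc zero))) (s≤s (s≤s (s≤s ())))
      (suc (suc (suc (suc zero)))) (suc (suc (suc (suc zero)))) (s≤s (s≤s (s≤s (s≤s ()))))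
      (suc (suc (suc (suc (suc _))))) (suc (suc (suc (suc zero)))) (s≤s (s≤s (s≤s (s≤s ()))))
      (suc (suc (suc (suc (suc zero))))) (suc (suc (suc (suc (suc zero)))))
        (s≤s (s≤s (s≤s (s≤s (s≤s ())))))
    where
    edge : ∀ {u v} → Edge G u v → u ≢ v × true ≡ adj G u v
    edge e = edge-irrefl e , ≡-sym e
    apart : ∀ {u v} → u ≡ a ⊎ u ≡ b ⊎ u ≡ c → v ≡ d ⊎ v ≡ e ⊎ v ≡ f →
            u ≢ v × false ≡ adj G u v
    apart u∈ v∈ = let u≢v , u≁v = far u∈ v∈ in u≢v , ≡-sym (nonEdge u≁v)

  -- The clique cutset is the complement of left ∪ right.
  record Separation : Set where
    field
      left right : Subset n
      disjoint   : ∀ {v} → v ∈ left → v ∉ right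
      apart      : ∀ {u v} → u ∈ left → v ∈ right → ¬ Edge G u v
      clique     : ∀ {u v} → u ∉ left → u ∉ right → v ∉ left → v ∉ right →
                   u ≢ v → Edge G u v
      left≢∅     : Nonempty left
      right≢∅    : Nonempty right

  swapSides : Separation → Separation
  swapSides s = record
    { left     = right
    ; right    = left
    ; disjoint = λ v∈R v∈L → disjoint v∈L v∈R
    ; apart    = λ u∈R v∈L e → apart v∈L u∈R (edge-sym e)
    ; clique   = λ u∉R u∉L v∉R v∉L → clique u∉L u∉R v∉L v∉R
    ; left≢∅   = right≢∅
    ; right≢∅  = left≢∅
    } where open Separation s

  reach-end : ∀ {S u v} → Reach G S u v → v ∈ S
  reach-end (here v∈S)   = v∈S
  reach-end (step _ _ r) = reach-end r

  reach-snoc : ∀ {S u v w} → Reach G S u v → Edge G v w → w ∈ S → Reach G S u w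
  reach-snoc (here v∈S)     e w∈S = step v∈S e (here w∈S)
  reach-snoc (step u∈S d r) e w∈S = step u∈S d (reach-snoc r e w∈S)

  -- The final goal is a negation, so reachability from `u` may be treated as decidable: excluded
  -- middle holds under a double negation at each of finitely many vertices. Then `right` is the
  -- component of `u` and `left` is the rest outside `X`.
  cutset⇒¬¬separation : ∀ {X} → IsCliqueCutset G X → ¬ ¬ Separation
  cutset⇒¬¬separation {X} (clX , u , v , u∈ , v∈ , ¬reach) ¬sep =
    sequence (RawMonad.rawApplicative ¬¬-Monad) (λ w → ¬¬-excluded-middle {A = Reach G (∁ X) u w})
      λ reach? →
        let far? : Decidable (λ w → w ∈ ∁ X × ¬ Reach G (∁ X) u w)
            far? w = (w ∈? ∁ X) ×-dec ¬? (reach? w)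
            inX : ∀ {w} → w ∉ select far? → w ∉ select reach? → w ∈ X
            inX w∉L w∉R = x∉∁p⇒x∈p λ w∈ → w∉L (∈-select⁺ far? (w∈ , w∉R ∘ ∈-select⁺ reach?))
        in ¬sep (record
          { left     = select far?
          ; right    = select reach?
          ; disjoint = λ w∈L w∈R → proj₂ (∈-select⁻ far? w∈L) (∈-select⁻ reach? w∈R)
          ; apart    = λ w∈L x∈R e → let w∈ , ¬r = ∈-select⁻ far? w∈L in
                         ¬r (reach-snoc (∈-select⁻ reach? x∈R) (edge-sym e) w∈)
          ; clique   = λ a∉L a∉R b∉L b∉R → clX (inX a∉L a∉R) (inX b∉L b∉R)
          ; left≢∅   = v , ∈-select⁺ far? (v∈ , ¬reach)
          ; right≢∅  = u , ∈-select⁺ reach? (here u∈)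
          })

  -- The larger clique may lie anywhere in `G`: only divisions of the whole graph are ever built, so
  -- a clique that misses the perfect part has to be compared with cliques of `G` only.
  Larger : Subset n → Set
  Larger K = ∃ λ L → Clique L × ∣ K ∣ < ∣ L ∣

  MissedLarger : Subset n → Subset n → Set
  MissedLarger W A = ∀ K → K ⊆ W → Clique K → (∀ {v} → v ∈ K → v ∉ A) → Larger K

  -- Perfect parts in a minimally nonperfectly divisible graph.

  module Minimal (minimal : MinimallyNonPerfectlyDivisible G) where

    divide : ∀ W → Nonempty W → (∃ λ v → v ∉ W) →
             ∃ λ A → A ⊆ W × Perf A × MissedLarger W A
    divide W W≢∅ (v , v∉W) with proj₂ minimal W (⊆⊤ , v , ∈⊤ , v∉W) W id W≢∅
    ... | A , B , parts , A⊆W , B⊆W , perfect , k , l , (_ , ω-B) ,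
          ((L , _ , clL , ∣L∣≡l) , _) , k<l =
      A , A⊆W , perfect⇒perf perfect , λ K K⊆W clK K∩A → L , clL ,
        subst (∣ K ∣ <_) (≡-sym ∣L∣≡l) (ℕ.≤-<-trans (ω-B K (λ v∈K →
          [ (λ h → contradiction (proj₁ h) (K∩A v∈K)) , proj₂ ]′ (parts (K⊆W v∈K))) clK) k<l)

    -- Such an `A` and its complement would divide the whole graph, and minimality divides every
    -- proper induced subgraph.
    undividable : ∀ {A} → Perf A → ¬ MissedLarger ⊤ A
    undividable {A} perf missed = proj₁ minimal divisible
      where
      divisible : PerfectlyDivisible G ⊤
      divisible T T⊆⊤ T≢∅ with full-or-missing T
      ... | inj₂ (v , v∉T) = proj₂ minimal T (⊆⊤ , v , ∈⊤ , v∉T) T id T≢∅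
      ... | inj₁ all = A , ∁ A , parts , (λ _ → all _) , (λ _ → all _) , perf⇒perfect perf , less
        where
        parts : ∀ {v} → v ∈ T → (v ∈ A × v ∉ ∁ A) ⊎ (v ∉ A × v ∈ ∁ A)
        parts {v} _ with v ∈? A
        ... | yes v∈A = inj₁ (v∈A , x∈p⇒x∉∁p v∈A)
        ... | no v∉A  = inj₂ (v∉A , x∉p⇒x∈∁p v∉A)
        less : CliqueNumberLess G (∁ A) T
        less with cliqueNumber (∁ A) | cliqueNumber T
        ... | k , ω-B@((K , K⊆ , clK , ∣K∣≡k) , _) | l , ω-T@(_ , bound)
          with missed K ⊆⊤ clK (x∈∁p⇒x∉p ∘ K⊆)
        ...   | L , clL , K<L =
          k , l , ω-B , ω-T , subst (_< l) ∣K∣≡k (ℕ.<-≤-trans K<L (bound L (λ _ → all _) clL))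

    -- The side left ∪ cut is cobipartite, so left may be added to a perfect part of right ∪ cut.
    left-not-clique : (s : Separation) → ¬ Clique (Separation.left s)
    left-not-clique s clL
      with divide (∁ left) (proj₁ right≢∅ , x∉p⇒x∈∁p λ v∈L → disjoint v∈L (proj₂ right≢∅))
                           (proj₁ left≢∅ , x∈p⇒x∉∁p (proj₂ left≢∅))
      where open Separation s
    ... | A , A⊆∁L , perfA , missed = undividable
      (perf-glue (λ u∈ v∈ → clA∩∁R (meet u∈) (meet v∈)) apart′
        (perf-cobipartite clL clA∩∁R (x∈p∪q⁻ left (A ∩ ∁ right))) perfA)
      -- A clique that misses `P ∪ A` misses `left`, so it lies where `A` is already a perfect part.
      λ K _ clK K∩ → missed K
        (λ v∈K → x∉p⇒x∈∁p λ v∈L → K∩ v∈K (p⊆p∪q A (p⊆p∪q (A ∩ ∁ right) v∈L))) clK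
        (λ v∈K v∈A → K∩ v∈K (q⊆p∪q P A v∈A))
      where
      open Separation s
      -- `A ∩ ∁ right` is the part of `A` in the cut. It is a clique and separates `left` from the
      -- rest of `A`.
      P = left ∪ (A ∩ ∁ right)
      ∉left : ∀ {v} → v ∈ A → v ∉ left
      ∉left = x∈∁p⇒x∉p ∘ A⊆∁L
      clA∩∁R : Clique (A ∩ ∁ right)
      clA∩∁R u∈ v∈ =
        let u∈A , u∉R = x∈p∩q⁻ A (∁ right) u∈
            v∈A , v∉R = x∈p∩q⁻ A (∁ right) v∈
        in clique (∉left u∈A) (x∈∁p⇒x∉p u∉R) (∉left v∈A) (x∈∁p⇒x∉p v∉R)
      meet : ∀ {v} → v ∈ P ∩ A → v ∈ A ∩ ∁ right
      meet v∈ = let v∈P , v∈A = x∈p∩q⁻ P A v∈ in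
        [ (λ v∈L → contradiction v∈L (∉left v∈A)) , id ]′ (x∈p∪q⁻ left _ v∈P)
      apart′ : ∀ {u v} → u ∈ P → u ∉ A → v ∈ A → v ∉ P → ¬ Edge G u v
      apart′ {u} {v} u∈P u∉A v∈A v∉P with x∈p∪q⁻ left _ u∈P | v ∈? right
      ... | inj₂ u∈ | _       = contradiction (proj₁ (x∈p∩q⁻ A _ u∈)) u∉A
      ... | inj₁ u∈L | yes v∈R = apart u∈L v∈R
      ... | inj₁ _ | no v∉R    =
        contradiction (q⊆p∪q left _ (x∈p∩q⁺ (v∈A , x∉p⇒x∈∁p v∉R))) v∉P

    -- Induced paths on both sides of the cut: the 2P₃-free case.

    -- Without an induced path on three vertices, adjacency is transitive on `left`, so the closed
    -- neighbourhood of a vertex `r` in `left` is a clique component. Moving the rest of `left` to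
    -- the right keeps the cut and makes the left side a clique, against `left-not-clique`.
    left-has-P3 : (s : Separation) → let open Separation s in
      ∃ λ a → ∃ λ b → ∃ λ c → a ∈ left × b ∈ left × c ∈ left × InducedP3 a b c
    left-has-P3 s with any? (λ a → any? λ b → any? λ c →
        (a ∈? left) ×-dec ((b ∈? left) ×-dec ((c ∈? left) ×-dec
        (edge? a b ×-dec (edge? b c ×-dec (¬? (edge? a c) ×-dec ¬? (a ≟ c)))))))
      where open Separation s
    ... | yes P3 = P3
    ... | no ∄P3 = ⊥-elim (left-not-clique s′ clL′)
      where
      open Separation s
      transitive : ∀ {a b c} → a ∈ left → b ∈ left → c ∈ left →
                   Edge G a b → Edge G b c → a ≢ c → Edge G a c
      transitive {a} {b} {c} a∈ b∈ c∈ ab bc a≢c = decidable-stable (edge? a c)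
        λ a≁c → ∄P3 (a , b , c , a∈ , b∈ , c∈ , ab , bc , a≁c , a≢c)
      r = proj₁ left≢∅
      r∈L = proj₂ left≢∅
      near? : ∀ v → Dec (v ≡ r ⊎ Edge G r v)
      near? v = (v ≟ r) ⊎-dec edge? r v
      L? : Decidable λ v → v ∈ left × (v ≡ r ⊎ Edge G r v)
      L? v = (v ∈? left) ×-dec near? v
      R? : Decidable λ v → v ∈ right ⊎ (v ∈ left × ¬ (v ≡ r ⊎ Edge G r v))
      R? v = (v ∈? right) ⊎-dec ((v ∈? left) ×-dec ¬? (near? v))
      clL′ : Clique (select L?)
      clL′ u∈ v∈ u≢v with ∈-select⁻ L? u∈ | ∈-select⁻ L? v∈
      ... | _ , inj₁ refl | _ , inj₁ refl = contradiction refl u≢v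
      ... | _ , inj₁ refl | _ , inj₂ rv = rv
      ... | _ , inj₂ ru | _ , inj₁ refl = edge-sym ru
      ... | u∈L , inj₂ ru | v∈L , inj₂ rv = transitive u∈L r∈L v∈L (edge-sym ru) rv u≢v
      ∉left : ∀ {v} → v ∉ select L? → v ∉ select R? → v ∉ left
      ∉left {v} v∉L v∉R v∈ with near? v
      ... | yes near = v∉L (∈-select⁺ L? (v∈ , near))
      ... | no ¬near = v∉R (∈-select⁺ R? (inj₂ (v∈ , ¬near)))
      ∉right : ∀ {v} → v ∉ select R? → v ∉ right
      ∉right v∉R v∈ = v∉R (∈-select⁺ R? (inj₁ v∈))
      disjoint′ : ∀ {v} → v ∈ select L? → v ∉ select R?
      disjoint′ v∈L v∈R with ∈-select⁻ L? v∈L | ∈-select⁻ R? v∈R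
      ... | v∈ , _    | inj₁ v∈R′       = disjoint v∈ v∈R′
      ... | _  , near | inj₂ (_ , ¬near) = ¬near near
      apart′ : ∀ {u v} → u ∈ select L? → v ∈ select R? → ¬ Edge G u v
      apart′ u∈L v∈R e with ∈-select⁻ L? u∈L | ∈-select⁻ R? v∈R
      ... | u∈ , _         | inj₁ v∈R′         = apart u∈ v∈R′ e
      ... | _  , inj₁ refl | inj₂ (_ , ¬near)  = ¬near (inj₂ e)
      ... | u∈ , inj₂ ru   | inj₂ (v∈ , ¬near) =
        ¬near (inj₂ (transitive r∈L u∈ v∈ ru e λ r≡v → ¬near (inj₁ (≡-sym r≡v))))
      s′ : Separation
      s′ = record
        { left     = select L?
        ; right    = select R?
        ; disjoint = disjoint′
        ; apart    = apart′
        ; clique   = λ u∉L u∉R v∉L v∉R →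
            clique (∉left u∉L u∉R) (∉right u∉R) (∉left v∉L v∉R) (∉right v∉R)
        ; left≢∅   = r , ∈-select⁺ L? (r∈L , inj₁ refl)
        ; right≢∅  = proj₁ right≢∅ , ∈-select⁺ R? (inj₁ (proj₂ right≢∅))
        }

    separation⇒2P3 : Separation → InducedCopy 2P3 G
    separation⇒2P3 s with left-has-P3 s | left-has-P3 (swapSides s)
    ... | _ , _ , _ , a∈ , b∈ , c∈ , abc | _ , _ , _ , d∈ , e∈ , f∈ , def =
      2P3-copy abc def λ u∈ v∈ →
        let u∈L = ∈side a∈ b∈ c∈ u∈
            v∈R = ∈side d∈ e∈ f∈ v∈
        in (λ { refl → disjoint u∈L v∈R }) , apart u∈L v∈R
      where
      open Separation s
      ∈side : ∀ {S : Subset n} {a b c u} → a ∈ S → b ∈ S → c ∈ S →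
              u ≡ a ⊎ u ≡ b ⊎ u ≡ c → u ∈ S
      ∈side a∈ b∈ c∈ (inj₁ refl) = a∈
      ∈side a∈ b∈ c∈ (inj₂ (inj₁ refl)) = b∈
      ∈side a∈ b∈ c∈ (inj₂ (inj₂ refl)) = c∈

    -- Separations described by one side, and how that side grows.

    Nbr : Subset n → Fin n → Set
    Nbr W v = ∃ λ w → w ∈ W × Edge G v w

    nbr? : ∀ W → Decidable (Nbr W)
    nbr? W v = any? λ w → (w ∈? W) ×-dec edge? v w

    Cut Far : Subset n → Fin n → Set
    Cut W v = v ∉ W × Nbr W v
    Far W v = v ∉ W × ¬ Nbr W v

    cut? : ∀ W → Decidable (Cut W)
    cut? W v = ¬? (v ∈? W) ×-dec nbr? W v

    far? : ∀ W → Decidable (Far W)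
    far? W v = ¬? (v ∈? W) ×-dec ¬? (nbr? W v)

    data Position (W : Subset n) (v : Fin n) : Set where
      inside : v ∈ W → Position W v
      cut    : Cut W v → Position W v
      far    : Far W v → Position W v

    position : ∀ W v → Position W v
    position W v with v ∈? W | nbr? W v
    ... | yes v∈W | _     = inside v∈W
    ... | no v∉W  | yes w = cut (v∉W , w)
    ... | no v∉W  | no ∄w = far (v∉W , ∄w)

    cut-¬far : ∀ {W v} → Cut W v → ¬ Far W v
    cut-¬far (_ , w) (_ , ∄w) = ∄w w

    far-apart : ∀ {W u v} → Far W u → v ∈ W → ¬ Edge G u v
    far-apart (_ , ∄w) v∈W e = ∄w (_ , v∈W , e)

    -- A separation determined by its right side `W`, which can therefore be enlarged. Its cut is
    -- the outer neighbourhood of `W`, so every cut vertex has a neighbour in `W`.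
    record Barrier (W : Subset n) : Set where
      field
        clique   : ∀ {u v} → Cut W u → Cut W v → u ≢ v → Edge G u v
        nonempty : Nonempty W
        far≢∅    : ∃ (Far W)

    -- A neighbour of `right` is never in `left`, so the new cut is contained in the old one. Old
    -- cut vertices without neighbours in `right` become far.
    separation⇒barrier : (s : Separation) → Barrier (Separation.right s)
    separation⇒barrier s = record
      { clique   = λ u v → clique (∉left u) (proj₁ u) (∉left v) (proj₁ v)
      ; nonempty = right≢∅
      ; far≢∅    = let v , v∈L = left≢∅ in
                   v , disjoint v∈L , λ (w , w∈R , e) → apart v∈L w∈R e
      }
      where
      open Separation s
      ∉left : ∀ {v} → Cut right v → v ∉ left
      ∉left (_ , w , w∈R , e) v∈L = apart v∈L w∈R e

    barrier⇒separation : ∀ {W} → Barrier W → Separation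
    barrier⇒separation {W} β = record
      { left     = select (far? W)
      ; right    = W
      ; disjoint = λ v∈L → proj₁ (∈-select⁻ (far? W) v∈L)
      ; apart    = λ u∈L → far-apart (∈-select⁻ (far? W) u∈L)
      ; clique   = λ u∉L u∉R v∉L v∉R → clique (isCut u∉L u∉R) (isCut v∉L v∉R)
      ; left≢∅   = proj₁ far≢∅ , ∈-select⁺ (far? W) (proj₂ far≢∅)
      ; right≢∅  = nonempty
      }
      where
      open Barrier β
      isCut : ∀ {v} → v ∉ select (far? W) → v ∉ W → Cut W v
      isCut {v} v∉L v∉W with position W v
      ... | inside v∈W = contradiction v∈W v∉W
      ... | cut v∈X    = v∈X
      ... | far v∈L    = contradiction (∈-select⁺ (far? W) v∈L) v∉L

    -- Vertices of the cut outside Y together with the far neighbours of Y; this contains the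
    -- cut around W ∪ Y.
    Shifted : Subset n → Subset n → Fin n → Set
    Shifted W Y v = (Cut W v × v ∉ Y) ⊎ (Far W v × Nbr Y v)

    ShiftedClique : Subset n → Subset n → Set
    ShiftedClique W Y = ∀ {u v} → Shifted W Y u → Shifted W Y v → u ≢ v → Edge G u v

    cut-∪⇒shifted : ∀ {W Y v} → Cut (W ∪ Y) v → Shifted W Y v
    cut-∪⇒shifted {W} {Y} {v} (v∉ , w , w∈ , e) with position W v
    ... | inside v∈W = contradiction (p⊆p∪q Y v∈W) v∉
    ... | cut v∈X    = inj₁ (v∈X , v∉ ∘ q⊆p∪q W Y)
    ... | far v∈L    = inj₂ (v∈L , w , [ (λ w∈W → contradiction e (far-apart v∈L w∈W)) , id ]′
                                        (x∈p∪q⁻ W Y w∈) , e)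

    -- The new cut consists of shifted vertices, so it is a clique. The new far side could be empty
    -- only if every far vertex had a neighbour in `Y`; then all far vertices would be shifted and
    -- the left side would be a clique, against `left-not-clique`.
    shift : ∀ {W Y} → Barrier W → (∀ {v} → v ∈ Y → Cut W v) → ShiftedClique W Y → Barrier (W ∪ Y)
    shift {W} {Y} β Y⊆X shifted with any? (λ v → far? W v ×-dec ¬? (nbr? Y v))
    ... | yes (v , v∈L , ∄y) = record
      { clique   = λ u v → shifted (cut-∪⇒shifted u) (cut-∪⇒shifted v)
      ; nonempty = let w , w∈W = Barrier.nonempty β in w , p⊆p∪q Y w∈W
      ; far≢∅    = v ,
          [ proj₁ v∈L , (λ v∈Y → cut-¬far (Y⊆X v∈Y) v∈L) ]′ ∘ x∈p∪q⁻ W Y ,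
          λ (w , w∈ , e) → [ (λ w∈W → far-apart v∈L w∈W e) , (λ w∈Y → ∄y (w , w∈Y , e)) ]′
                             (x∈p∪q⁻ W Y w∈)
      }
    ... | no all-near = ⊥-elim (left-not-clique (barrier⇒separation β) λ u∈L v∈L →
            shifted (inj₂ (near (∈-select⁻ (far? W) u∈L))) (inj₂ (near (∈-select⁻ (far? W) v∈L))))
      where
      near : ∀ {v} → Far W v → Far W v × Nbr Y v
      near {v} v∈L = v∈L , decidable-stable (nbr? Y v) λ ∄y → all-near (v , v∈L , ∄y)

    Maximal : Subset n → Set
    Maximal W = ∀ {Y} → Nonempty Y → (∀ {v} → v ∈ Y → Cut W v) → ¬ ShiftedClique W Y

    -- Every shift moves a cut vertex into `W`, so `∁ W` shrinks and shifting must stop at a maximal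
    -- barrier.
    maximise : (∀ {W} → Barrier W → ¬ Maximal W) → ∀ {W} → ¬ Barrier W
    maximise noMax {W} = go (<-wellFounded _)
      where
      go : ∀ {W} → Acc _<_ ∣ ∁ W ∣ → ¬ Barrier W
      go {W} (acc rec) β = noMax β λ {Y} (y , y∈Y) Y⊆X shifted →
        go (rec (p⊂q⇒∣p∣<∣q∣ (p⊂q⇒∁p⊃∁q
          (p⊆p∪q Y , y , q⊆p∪q W Y y∈Y , proj₁ (Y⊆X y∈Y))))) (shift β Y⊆X shifted)

    -- Neighbourhoods of cut vertices around a maximal barrier: the claw-free case.

    module _ (clawFree : Free claw G) {W} (β : Barrier W) (maximal : Maximal W) where

      open Barrier β

      -- Otherwise `a`, `b` and a neighbour of `x` in `W` form a claw centred at `x`.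
      far-clique : ∀ {x a b} → Cut W x → Far W a → Far W b →
                   Edge G x a → Edge G x b → a ≢ b → Edge G a b
      far-clique {x} {a} {b} (_ , w , w∈W , xw) a∈L b∈L xa xb a≢b =
        decidable-stable (edge? a b) λ a≁b → clawFree (claw-copy xa xb xw a≢b
          (λ { refl → proj₁ a∈L w∈W }) (λ { refl → proj₁ b∈L w∈W })
          a≁b (far-apart a∈L w∈W) (far-apart b∈L w∈W))

      -- If `x` had no far neighbour, shifting across `x` alone would leave only old cut vertices,
      -- which form a clique, against maximality.
      cut-far : ∀ {x} → Cut W x → ∃ λ a → Far W a × Edge G x a
      cut-far {x} x∈X = decidable-stable (any? λ a → far? W a ×-dec edge? x a) λ ∄a →
        let isCut : ∀ {v} → Shifted W ⁅ x ⁆ v → Cut W v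
            isCut = λ where
              (inj₁ (v∈X , _)) → v∈X
              (inj₂ (v∈L , y , y∈ , vy)) → contradiction
                (_ , v∈L , edge-sym (subst (Edge G _) (x∈⁅y⁆⇒x≡y x y∈) vy)) ∄a
        in maximal (x , x∈⁅x⁆ x) (λ v∈ → subst (Cut W) (≡-sym (x∈⁅y⁆⇒x≡y x v∈)) x∈X)
             λ u v → clique (isCut u) (isCut v)

      -- The mirror image of `far-clique`; the third leaf of the claw is the far neighbour supplied
      -- by `cut-far`.
      inside-clique : ∀ {x a b} → Cut W x → a ∈ W → b ∈ W →
                      Edge G x a → Edge G x b → a ≢ b → Edge G a b
      inside-clique {x} {a} {b} x∈X a∈W b∈W xa xb a≢b with cut-far x∈X
      ... | c , c∈L , xc = decidable-stable (edge? a b) λ a≁b →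
        clawFree (claw-copy xc xa xb
          (λ { refl → proj₁ c∈L a∈W }) (λ { refl → proj₁ c∈L b∈W }) a≢b
          (far-apart c∈L a∈W) (far-apart c∈L b∈W) a≁b)

      -- Otherwise `a`, `b` and `y` form a claw centred at `x`.
      far-⊆ : ∀ {x y b} → Cut W x → Cut W y → b ∈ W → Edge G x b → ¬ Edge G y b →
              ∀ {a} → Far W a → Edge G x a → Edge G y a
      far-⊆ {x} {y} {b} x∈X y∈X b∈W xb y≁b {a} a∈L xa = decidable-stable (edge? y a)
        λ y≁a → clawFree (claw-copy xa xb (clique x∈X y∈X λ { refl → y≁a xa })
          (λ { refl → proj₁ a∈L b∈W })
          (λ { refl → cut-¬far y∈X a∈L })
          (λ { refl → proj₁ y∈X b∈W })
          (far-apart a∈L b∈W) (y≁a ∘ edge-sym) (y≁b ∘ edge-sym))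

      -- If b ∈ N(y) \ N(x), shift the cut across all z with N(z) ⊈ N(x) inside W: the far
      -- neighbours of such z are common neighbours of x and of all cut vertices that remain.
      inside-nbrs-agree : ∀ {x y b} → Cut W x → Cut W y → b ∈ W → Edge G y b → Edge G x b
      inside-nbrs-agree {x} {y} {b} x∈X y∈X b∈W yb = decidable-stable (edge? x b) λ x≁b →
        maximal (y , ∈-select⁺ Y? (y∈X , b , b∈W , yb , x≁b)) (proj₁ ∘ ∈-select⁻ Y?) shifted
        where
        Y? : Decidable λ z → Cut W z × ∃ λ b → b ∈ W × Edge G z b × ¬ Edge G x b
        Y? z = cut? W z ×-dec any? λ b → (b ∈? W) ×-dec (edge? z b ×-dec ¬? (edge? x b))
        -- The vertex `z` that brings `a` into the shifted cut has a neighbour `b` in `W` outside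
        -- the neighbourhood of `x`. As `t` is not in the shifted set, it misses `b`, and `far-⊆`
        -- passes far neighbours from `z` to `t`.
        toCut : ∀ {t a} → Cut W t → t ∉ select Y? → Far W a → Nbr (select Y?) a → Edge G t a
        toCut {t} t∈X t∉Y a∈L (z , z∈Y , az) with ∈-select⁻ Y? z∈Y
        ... | z∈X , b , b∈W , zb , x≁b = far-⊆ z∈X t∈X b∈W zb
                (λ tb → t∉Y (∈-select⁺ Y? (t∈X , b , b∈W , tb , x≁b))) a∈L (edge-sym az)
        x∉Y : x ∉ select Y?
        x∉Y x∈Y = let _ , b , _ , xb , x≁b = ∈-select⁻ Y? x∈Y in x≁b xb
        shifted : ShiftedClique W (select Y?)
        shifted (inj₁ (u∈X , _)) (inj₁ (v∈X , _)) = clique u∈X v∈X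
        shifted (inj₁ (u∈X , u∉Y)) (inj₂ (v∈L , vY)) _ = toCut u∈X u∉Y v∈L vY
        shifted (inj₂ (u∈L , uY)) (inj₁ (v∈X , v∉Y)) _ = edge-sym (toCut v∈X v∉Y u∈L uY)
        -- `x` itself stays in the cut, so both far vertices are neighbours of `x`.
        shifted (inj₂ (u∈L , uY)) (inj₂ (v∈L , vY)) =
          far-clique x∈X u∈L v∈L (toCut x∈X x∉Y u∈L uY) (toCut x∈X x∉Y v∈L vY)

      -- The far neighbours of a cut vertex form a clique, so it is simplicial over a set of far
      -- vertices.
      meetCut : ∀ {A} → A ⊆ ∁ W → Perf A →
        ∃ λ A′ → A′ ⊆ ∁ W × A ⊆ A′ × Perf A′ ×
          (∀ {y} → Cut W y → ∃ λ x → x ∈ A′ × Cut W x)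
      meetCut {A} A⊆ perfA with any? (λ x → (x ∈? A) ×-dec cut? W x) | any? (cut? W)
      ... | yes x | _ = A , A⊆ , id , perfA , λ _ → x
      ... | no _ | no ∄x = A , A⊆ , id , perfA , λ y∈X → contradiction (_ , y∈X) ∄x
      -- Here `A` has far vertices only. The clique `C` of `x` and its neighbours in `A` is glued to
      -- `A` along these neighbours.
      ... | no A∩X | yes (x , x∈X) = A ∪ C , A∪C⊆ , p⊆p∪q C ,
            perf-glue (λ u∈ v∈ → clC (p∩q⊆q A C u∈) (p∩q⊆q A C v∈)) apart perfA
              (perf-cobipartite clC clC inj₁) ,
            λ _ → x , q⊆p∪q A C (∈-select⁺ C? (inj₁ refl)) , x∈X
        where
        C? : Decidable λ v → v ≡ x ⊎ (v ∈ A × Edge G x v)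
        C? v = (v ≟ x) ⊎-dec ((v ∈? A) ×-dec edge? x v)
        C = select C?
        A-far : ∀ {v} → v ∈ A → Far W v
        A-far {v} v∈A with position W v
        ... | inside v∈W = contradiction v∈W (x∈∁p⇒x∉p (A⊆ v∈A))
        ... | cut v∈X    = contradiction (v , v∈A , v∈X) A∩X
        ... | far v∈L    = v∈L
        A∪C⊆ : A ∪ C ⊆ ∁ W
        A∪C⊆ v∈ with x∈p∪q⁻ A C v∈
        ... | inj₁ v∈A = A⊆ v∈A
        ... | inj₂ v∈C with ∈-select⁻ C? v∈C
        ...   | inj₁ refl = x∉p⇒x∈∁p (proj₁ x∈X)
        ...   | inj₂ (v∈A , _) = A⊆ v∈A
        clC : Clique C
        clC u∈C v∈C u≢v with ∈-select⁻ C? u∈C | ∈-select⁻ C? v∈C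
        ... | inj₁ refl | inj₁ refl = contradiction refl u≢v
        ... | inj₁ refl | inj₂ (_ , xv) = xv
        ... | inj₂ (_ , xu) | inj₁ refl = edge-sym xu
        ... | inj₂ (u∈A , xu) | inj₂ (v∈A , xv) = far-clique x∈X (A-far u∈A) (A-far v∈A) xu xv u≢v
        apart : ∀ {u v} → u ∈ A → u ∉ C → v ∈ C → v ∉ A → ¬ Edge G u v
        apart u∈A u∉C v∈C v∉A e with ∈-select⁻ C? v∈C
        ... | inj₁ refl = u∉C (∈-select⁺ C? (inj₂ (u∈A , edge-sym e)))
        ... | inj₂ (v∈A , _) = v∉A v∈A

      -- The perfect parts of the two sides are joined through the clique `C`, which consists of the
      -- cut vertices in `A` and the vertices of `A₂` adjacent to the cut. It is a clique because
      -- all cut vertices have the same neighbours in `W`, and these are pairwise adjacent. First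
      -- `C` is glued to `A`, then `A₂` to the result.
      ¬maximal : False
      ¬maximal
        with divide (∁ W) (proj₁ far≢∅ , x∉p⇒x∈∁p (proj₁ (proj₂ far≢∅)))
                          (proj₁ nonempty , x∈p⇒x∉∁p (proj₂ nonempty))
           | divide W nonempty (proj₁ far≢∅ , proj₁ (proj₂ far≢∅))
      ... | A₁ , A₁⊆ , perf₁ , missed₁ | A₂ , A₂⊆W , perf₂ , missed₂ with meetCut A₁⊆ perf₁
      ...   | A , A⊆ , A₁⊆A , perfA , hitCut =
        undividable (perf-glue meet apart′
          (perf-glue (λ u∈ v∈ → clC (p∩q⊆q A C u∈) (p∩q⊆q A C v∈)) apart perfA
            (perf-cobipartite clC clC inj₁)) perf₂) missed
        where
        C? : Decidable λ v → (v ∈ A × Cut W v) ⊎ (v ∈ A₂ × ∃ λ x → Cut W x × Edge G x v)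
        C? v = ((v ∈? A) ×-dec cut? W v) ⊎-dec
               ((v ∈? A₂) ×-dec any? λ x → cut? W x ×-dec edge? x v)
        C = select C?
        clC : Clique C
        clC u∈C v∈C u≢v with ∈-select⁻ C? u∈C | ∈-select⁻ C? v∈C
        ... | inj₁ (_ , u∈X) | inj₁ (_ , v∈X) = clique u∈X v∈X u≢v
        ... | inj₁ (_ , u∈X) | inj₂ (v∈A₂ , x , x∈X , xv) =
          inside-nbrs-agree u∈X x∈X (A₂⊆W v∈A₂) xv
        ... | inj₂ (u∈A₂ , x , x∈X , xu) | inj₁ (_ , v∈X) =
          edge-sym (inside-nbrs-agree v∈X x∈X (A₂⊆W u∈A₂) xu)
        ... | inj₂ (u∈A₂ , x , x∈X , xu) | inj₂ (v∈A₂ , y , y∈X , yv) =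
          inside-clique x∈X (A₂⊆W u∈A₂) (A₂⊆W v∈A₂) xu
            (inside-nbrs-agree x∈X y∈X (A₂⊆W v∈A₂) yv) u≢v
        apart : ∀ {u v} → u ∈ A → u ∉ C → v ∈ C → v ∉ A → ¬ Edge G u v
        apart {u} u∈A u∉C v∈C v∉A e with position W u | ∈-select⁻ C? v∈C
        ... | _          | inj₁ (v∈A , _)  = v∉A v∈A
        ... | inside u∈W | _               = x∈∁p⇒x∉p (A⊆ u∈A) u∈W
        ... | cut u∈X    | _               = u∉C (∈-select⁺ C? (inj₁ (u∈A , u∈X)))
        ... | far u∈L    | inj₂ (v∈A₂ , _) = far-apart u∈L (A₂⊆W v∈A₂) e
        meet⊆C : ∀ {v} → v ∈ (A ∪ C) ∩ A₂ → v ∈ C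
        meet⊆C v∈ = let v∈AC , v∈A₂ = x∈p∩q⁻ (A ∪ C) A₂ v∈ in
          [ (λ v∈A → contradiction (A₂⊆W v∈A₂) (x∈∁p⇒x∉p (A⊆ v∈A))) , id ]′ (x∈p∪q⁻ A C v∈AC)
        meet : Clique ((A ∪ C) ∩ A₂)
        meet u∈ v∈ = clC (meet⊆C u∈) (meet⊆C v∈)
        apart′ : ∀ {u v} → u ∈ A ∪ C → u ∉ A₂ → v ∈ A₂ → v ∉ A ∪ C → ¬ Edge G u v
        apart′ {u} {v} u∈ u∉A₂ v∈A₂ v∉ e with x∈p∪q⁻ A C u∈ | position W u
        ... | _ | cut u∈X = v∉ (q⊆p∪q A C (∈-select⁺ C? (inj₂ (v∈A₂ , u , u∈X , e))))
        ... | _ | far u∈L = far-apart u∈L (A₂⊆W v∈A₂) e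
        ... | inj₁ u∈A | inside u∈W = x∈∁p⇒x∉p (A⊆ u∈A) u∈W
        ... | inj₂ u∈C | inside u∈W with ∈-select⁻ C? u∈C
        ...   | inj₁ (u∈A , _) = x∈∁p⇒x∉p (A⊆ u∈A) u∈W
        ...   | inj₂ (u∈A₂ , _) = u∉A₂ u∈A₂
        missed : MissedLarger ⊤ ((A ∪ C) ∪ A₂)
        missed K _ clK K∩ with any? (λ v → (v ∈? K) ×-dec far? W v)
                             | any? (λ v → (v ∈? K) ×-dec cut? W v)
        -- A clique with a far vertex has no vertex in `W`, so the part chosen in `∁ W` handles it.
        ... | yes (v , v∈K , v∈L) | _ = missed₁ K
              (λ w∈K → x∉p⇒x∈∁p λ w∈W → far-apart v∈L w∈W
                (clK v∈K w∈K λ { refl → proj₁ v∈L w∈W })) clK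
              λ w∈K w∈A₁ → K∩ w∈K (p⊆p∪q A₂ (p⊆p∪q C (A₁⊆A w∈A₁)))
        -- Now `K` lies in the cut and `W`. The cut vertex `x` of `A` is not in `K`, is adjacent to
        -- the cut vertices of `K`, and shares the neighbours of `y` in `W`, so it enlarges `K`.
        ... | no K∩L | yes (y , y∈K , y∈X) with hitCut y∈X
        ...   | x , x∈A , x∈X = K ∪ ⁅ x ⁆ , clique-insert clK joined , ∣insert∣ x∉K
          where
          x∉K : x ∉ K
          x∉K x∈K = K∩ x∈K (p⊆p∪q A₂ (p⊆p∪q C x∈A))
          joined : ∀ {u} → u ∈ K → Edge G u x
          joined {u} u∈K with position W u
          ... | inside u∈W = edge-sym (inside-nbrs-agree x∈X y∈X u∈W
                               (clK y∈K u∈K λ { refl → proj₁ y∈X u∈W }))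
          ... | cut u∈X    = clique u∈X x∈X λ { refl → x∉K u∈K }
          ... | far u∈L    = contradiction (u , u∈K , u∈L) K∩L
        missed K _ clK K∩ | no K∩L | no K∩X = missed₂ K K⊆W clK
              λ v∈K v∈A₂ → K∩ v∈K (q⊆p∪q (A ∪ C) A₂ v∈A₂)
          where
          K⊆W : K ⊆ W
          K⊆W {v} v∈K with position W v
          ... | inside v∈W = v∈W
          ... | cut v∈X    = contradiction (v , v∈K , v∈X) K∩X
          ... | far v∈L    = contradiction (v , v∈K , v∈L) K∩L

    clawFree⇒¬separation : Free claw G → ¬ Separation
    clawFree⇒¬separation clawFree s = maximise (¬maximal clawFree) (separation⇒barrier s)

theorem4 : (n : ℕ) (G : Graph n) → (Free 2P3 G ⊎ Free claw G)
    → MinimallyNonPerfectlyDivisible G → ¬ HasCliqueCutset G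
theorem4 n G free minimal (_ , X , cutset) =
  cutset⇒¬¬separation cutset λ s →
    [ (λ 2P3Free → 2P3Free (separation⇒2P3 s)) ,
      (λ clawFree → clawFree⇒¬separation clawFree s) ]′ free
  where
  open Cutsets G
  open Minimal minimal
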